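{- Let $n\ge 1$ and let $w \in \mathfrak{S}_n$. Then the depth of $w$ is given by $$\mathrm{dp}(w) = \sum_{i\in\{1,\dots,n\}:\ w(i) > i} (w(i)-i).$$
   Context: $\mathfrak{S}_n$ is the group of permutations of $\{1,\dots,n\}$. For $1\le i<j\le n$, $t_{ij}\in\mathfrak{S}_n$ denotes the transposition interchanging $i$ and $j$; its depth is $j-i$. The depth of $w\in\mathfrak{S}_n$ is the minimum total depth of a factorization of $w$ into transpositions: $$\mathrm{dp}(w)=\min\Big\{\sum_{r=1}^k (j_r-i_r) : k\ge 0,\ w=t_{i_1j_1}\cdots t_{i_kj_k},\ i_r<j_r\Big\},$$ where the identity is the empty product, of depth $0$. -}

module Defs where

open import Data.Fin.Base using (Fin; toℕ; _<_)
import Data.Fin.Properties as Fin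
open import Data.Fin.Permutation using (Permutation′; _⟨$⟩ʳ_; _≈_; transpose)
import Data.Fin.Permutation.Components as PC
open import Data.Fin.Permutation.Transposition.List
  using (TranspositionList; eval; decompose; eval-decompose)
open import Data.List.Base
  using (List; []; _∷_; map; length; allFin; cartesianProduct; cartesianProductWith)
open import Data.List.Membership.Propositional using (_∈_; lose)
open import Data.List.Membership.Propositional.Properties
  using (∈-allFin; ∈-cartesianProduct⁺; ∈-cartesianProductWith⁺)
open import Data.List.Relation.Unary.All using (All; []; _∷_; all?)
open import Data.List.Relation.Unary.Any using (here; there; any?; satisfied)
open import Data.Nat.Base as ℕ using (ℕ; zero; suc; _∸_; z≤n; s≤s)
open import Data.Nat.ListAction using (sum)
import Data.Nat.Properties as ℕ
open import Data.Nat.Induction using (<-rec)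
open import Data.Product.Base using (_×_; _,_; ∃; ∃-syntax; proj₁; proj₂)
open import Function.Base using (_∘_)
open import Relation.Binary.Definitions using (tri<; tri≈; tri>)
open import Relation.Binary.PropositionalEquality
  using (_≡_; refl; sym; trans; cong)
open import Relation.Nullary using (yes; no)
open import Relation.Nullary.Decidable using (map′; _×-dec_; dec-true; dec-false)
open import Relation.Unary using (Pred; Decidable)
open import Level using (0ℓ)

private
  variable
    n : ℕ

-- {1,…,n} is modelled by Fin n = {0,…,n-1}; depths and the sum of excesses
-- only involve order and differences, so the shift is harmless.

totalDepth : TranspositionList n → ℕ
totalDepth ts = sum (map (λ (i , j) → toℕ j ∸ toℕ i) ts)

-- A pair (i , j) in a TranspositionList is unrestricted (it may even have
-- i ≡ j), hence the condition i < j.  The library's eval applies the head of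
-- the list first; under the opposite convention one reverses the list, which
-- does not change its total depth.
IsFactorization : Permutation′ n → TranspositionList n → Set
IsFactorization w ts = All (λ (i , j) → i < j) ts × eval ts ≈ w

FactorizationDepth : Permutation′ n → Pred ℕ 0ℓ
FactorizationDepth w d = ∃[ ts ] (IsFactorization w ts × totalDepth ts ≡ d)

IsMinimum : Pred ℕ 0ℓ → ℕ → Set
IsMinimum P m = P m × (∀ {k} → P k → m ℕ.≤ k)

private
  minimum : {P : Pred ℕ 0ℓ} → Decidable P → ∃ P → ∃ (IsMinimum P)
  minimum {P} P? (m , pm) = <-rec (λ m → P m → ∃ (IsMinimum P)) step m pm
    where
    step : ∀ m → (∀ {k} → k ℕ.< m → P k → ∃ (IsMinimum P)) → P m → ∃ (IsMinimum P)
    step m rec pm with ℕ.anyUpTo? P? m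
    ... | yes (k , k<m , pk) = rec k<m pk
    ... | no none = m , pm , λ {k} pk → ℕ.≮⇒≥ λ k<m → none (k , k<m , pk)

  -- All lists of pairs of length at most k.
  words : ∀ n → ℕ → List (TranspositionList n)
  words n zero    = [] ∷ []
  words n (suc k) =
    [] ∷ cartesianProductWith _∷_ (cartesianProduct (allFin n) (allFin n)) (words n k)

  ∈-words : ∀ k (ts : TranspositionList n) → length ts ℕ.≤ k → ts ∈ words n k
  ∈-words zero    []             _       = here refl
  ∈-words (suc k) []             _       = here refl
  ∈-words (suc k) ((i , j) ∷ ts) (s≤s p) =
    there (∈-cartesianProductWith⁺ _∷_
      (∈-cartesianProduct⁺ (∈-allFin i) (∈-allFin j)) (∈-words k ts p))

  length≤totalDepth : (ts : TranspositionList n) → All (λ (i , j) → i < j) ts →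
                      length ts ℕ.≤ totalDepth ts
  length≤totalDepth []       []         = z≤n
  length≤totalDepth (_ ∷ ts) (i<j ∷ ps) =
    ℕ.+-mono-≤ (ℕ.m<n⇒0<n∸m i<j) (length≤totalDepth ts ps)

  isFactorization? : (w : Permutation′ n) → Decidable (IsFactorization w)
  isFactorization? w ts =
    all? (λ (i , j) → i Fin.<? j) ts ×-dec
    Fin.all? (λ k → (eval ts ⟨$⟩ʳ k) Fin.≟ (w ⟨$⟩ʳ k))

  factorizationDepth? : (w : Permutation′ n) → Decidable (FactorizationDepth w)
  factorizationDepth? {n} w d = map′ satisfied complete
    (any? (λ ts → isFactorization? w ts ×-dec (totalDepth ts ℕ.≟ d)) (words n d))
    where
    complete : FactorizationDepth w d → _
    complete (ts , f , refl) =
      lose (∈-words d ts (length≤totalDepth ts (proj₁ f))) (f , refl)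

  transpose-refl : (i k : Fin n) → PC.transpose i i k ≡ k
  transpose-refl i k with k Fin.≟ i
  ... | yes k≡i = sym k≡i
  ... | no  k≢i rewrite dec-false (k Fin.≟ i) k≢i = refl

  transpose-comm : (i j k : Fin n) → PC.transpose i j k ≡ PC.transpose j i k
  transpose-comm i j k with k Fin.≟ i
  ... | yes k≡i with k Fin.≟ j
  ...   | yes k≡j = trans (sym k≡j) k≡i
  ...   | no  _   rewrite dec-true (k Fin.≟ i) k≡i = refl
  transpose-comm i j k | no k≢i with k Fin.≟ j
  ...   | yes _   = refl
  ...   | no  _   rewrite dec-false (k Fin.≟ i) k≢i = refl

  orient : (ts : TranspositionList n) → ∃ (IsFactorization (eval ts))
  orient [] = [] , [] , λ _ → refl
  orient ((i , j) ∷ ts) with orient ts | Fin.<-cmp i j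
  ... | us , ps , e | tri< i<j _ _ = (i , j) ∷ us , i<j ∷ ps , λ k → e _
  ... | us , ps , e | tri≈ _ refl _ =
    us , ps , λ k → trans (e k) (cong (eval ts ⟨$⟩ʳ_) (sym (transpose-refl i k)))
  ... | us , ps , e | tri> _ _ j<i =
    (j , i) ∷ us , j<i ∷ ps ,
    λ k → trans (e _) (cong (eval ts ⟨$⟩ʳ_) (transpose-comm j i k))

  factorizationExists : (w : Permutation′ n) → ∃ (FactorizationDepth w)
  factorizationExists w with orient (decompose w)
  ... | ts , ps , e =
    totalDepth ts , ts , (ps , λ k → trans (e k) (eval-decompose w k)) , refl

minimalDepth : (w : Permutation′ n) → ∃ (IsMinimum (FactorizationDepth w))
minimalDepth w = minimum (factorizationDepth? w) (factorizationExists w)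

dp : Permutation′ n → ℕ
dp w = proj₁ (minimalDepth w)

dp-isMinimum : (w : Permutation′ n) → IsMinimum (FactorizationDepth w) (dp w)
dp-isMinimum w = proj₂ (minimalDepth w)

{-# OPTIONS --safe #-}
module Submission where

-- Write E(w) for the sum of the excesses w(i) ∸ i over all i; truncated
-- subtraction makes it the sum over the i with w(i) > i.
--
-- Lower bound: x ∸ z ≤ (x ∸ y) + (y ∸ z) makes E subadditive under composition
-- (the sum for one factor is reindexed by the other), and E(t_ij) = j − i, so
-- E(w) is at most the total depth of any factorization of w.
--
-- Upper bound: if w is not the identity, there are i < j with w(j) ≤ i and
-- j ≤ w(i).  For such i and j the inequalities above are equalities at every
-- point, so splitting off t_ij costs j − i and lowers E by exactly j − i;
-- recurse on E.

open import Defs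
open import Data.Nat.Base using (ℕ; _≤_; _∸_; zero; suc; _+_; _<_; z≤n)
open import Data.Nat.ListAction using (sum)
open import Data.Fin.Base as Fin using (Fin; zero; suc; toℕ; fromℕ<; punchIn)
open import Data.Fin.Properties using (_<?_)
open import Data.Fin.Permutation using (Permutation′; _⟨$⟩ʳ_; _∘ₚ_; transpose)
open import Data.List.Base using ([]; _∷_; map; filter; allFin; tabulate)
open import Relation.Binary.PropositionalEquality
  using (_≡_; _≢_; refl; sym; trans; cong; cong₂; subst; module ≡-Reasoning)

open import Data.Fin.Induction using (>-wellFounded)
import Data.Fin.Permutation.Components as PC
open import Data.Fin.Permutation.Transposition.List using (eval)
import Data.Fin.Properties as Fin
open import Data.List.Properties using (map-tabulate)
open import Data.List.Relation.Unary.All using (All; []; _∷_)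
open import Data.Nat.Induction using (<-rec)
import Data.Nat.Properties as ℕ
open import Data.Product.Base using (_×_; _,_; ∃; ∃₂; proj₁; proj₂)
open import Data.Sum.Base using (_⊎_; inj₁; inj₂)
open import Function.Base using (id; _∘_)
open import Function.Bundles using (module Injection)
open import Function.Properties.Inverse using (↔⇒↣)
open import Induction.WellFounded using (Acc; acc)
open import Relation.Nullary using (¬_; yes; no; contradiction)
open import Relation.Unary using (Pred; Decidable)
open import Algebra.Properties.CommutativeMonoid.Sum ℕ.+-0-commutativeMonoid
  using (sum-cong-≗; sum-replicate-zero; ∑-distrib-+; sum-permute; sum-remove)
  renaming (sum to ∑)

private
  variable
    n : ℕ

∑-mono-≤ : {f g : Fin n → ℕ} → (∀ k → f k ≤ g k) → ∑ f ≤ ∑ g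
∑-mono-≤ {zero}  f≤g = z≤n
∑-mono-≤ {suc n} f≤g = ℕ.+-mono-≤ (f≤g zero) (∑-mono-≤ (f≤g ∘ suc))

∑-zero : {f : Fin n → ℕ} → (∀ k → f k ≡ 0) → ∑ f ≡ 0
∑-zero {n} f≡0 = trans (sum-cong-≗ f≡0) (sum-replicate-zero n)

∑-single : {f : Fin n → ℕ} (i : Fin n) → (∀ k → k ≢ i → f k ≡ 0) → ∑ f ≡ f i
∑-single {suc n} {f} i f≡0 = begin
  ∑ f                      ≡⟨ sum-remove {i = i} f ⟩
  f i + ∑ (f ∘ punchIn i)  ≡⟨ cong (f i +_) (∑-zero (λ k → f≡0 _ (Fin.punchInᵢ≢i i k))) ⟩
  f i + 0                  ≡⟨ ℕ.+-identityʳ (f i) ⟩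
  f i                      ∎
  where open ≡-Reasoning

sum-tabulate : (f : Fin n → ℕ) → sum (tabulate f) ≡ ∑ f
sum-tabulate {zero}  f = refl
sum-tabulate {suc n} f = cong (f zero +_) (sum-tabulate (f ∘ suc))

-- Truncation does no harm: `y + (x ∸ y)` is the maximum of `x` and `y`, so going from `z` to `x` by
-- way of `y` never falls short.
∸-triangle : ∀ x y z → x ∸ z ≤ (x ∸ y) + (y ∸ z)
∸-triangle x y z = ℕ.m≤n+o⇒m∸n≤o x z (begin
  x                        ≤⟨ ℕ.m≤n+m∸n x y ⟩
  y + (x ∸ y)              ≤⟨ ℕ.+-monoˡ-≤ (x ∸ y) (ℕ.m≤n+m∸n y z) ⟩
  z + (y ∸ z) + (x ∸ y)    ≡⟨ ℕ.+-assoc z (y ∸ z) (x ∸ y) ⟩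
  z + ((y ∸ z) + (x ∸ y))  ≡⟨ cong (z +_) (ℕ.+-comm (y ∸ z) (x ∸ y)) ⟩
  z + ((x ∸ y) + (y ∸ z))  ∎)
  where open ℕ.≤-Reasoning

∸-split : ∀ {x y z} → z ≤ y → y ≤ x → x ∸ z ≡ (x ∸ y) + (y ∸ z)
∸-split {x} {y} {z} z≤y y≤x = begin
  x ∸ z              ≡⟨ cong (_∸ z) (ℕ.m∸n+n≡m y≤x) ⟨
  (x ∸ y) + y ∸ z    ≡⟨ ℕ.+-∸-assoc (x ∸ y) z≤y ⟩
  (x ∸ y) + (y ∸ z)  ∎
  where open ≡-Reasoning

-- With `P` binary, hypotheses on `k` such as `k ≢ i` can be built into it, and the comparisons
-- inside `PC.transpose` are handled once.
transpose-elim : ∀ {p} (P : Fin n → Fin n → Set p) {i j} → P i j → P j i →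
                 (∀ k → k ≢ i → k ≢ j → P k k) → ∀ k → P k (PC.transpose i j k)
transpose-elim P {i} {j} Pij Pji Pkk k with k Fin.≟ i
... | yes refl = Pij
... | no k≢i with k Fin.≟ j
...   | yes refl = Pji
...   | no k≢j = Pkk k k≢i k≢j

excess : Permutation′ n → ℕ
excess w = ∑ λ k → toℕ (w ⟨$⟩ʳ k) ∸ toℕ k

excess-cong : {v w : Permutation′ n} → (∀ k → v ⟨$⟩ʳ k ≡ w ⟨$⟩ʳ k) → excess v ≡ excess w
excess-cong v≈w = sum-cong-≗ λ k → cong (λ l → toℕ l ∸ toℕ k) (v≈w k)

-- At most `i` is raised: `j` goes to `i`, which truncates to 0, and all other points are fixed.
excess-transpose : {i j : Fin n} → toℕ i ≤ toℕ j → excess (transpose i j) ≡ toℕ j ∸ toℕ i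
excess-transpose {i = i} {j} i≤j = begin
  excess (transpose i j)            ≡⟨ ∑-single i unmoved-or-lowered ⟩
  toℕ (PC.transpose i j i) ∸ toℕ i  ≡⟨ cong (λ l → toℕ l ∸ toℕ i) transpose-left ⟩
  toℕ j ∸ toℕ i                     ∎
  where
  open ≡-Reasoning

  unmoved-or-lowered : ∀ k → k ≢ i → toℕ (PC.transpose i j k) ∸ toℕ k ≡ 0
  unmoved-or-lowered = transpose-elim (λ k l → k ≢ i → toℕ l ∸ toℕ k ≡ 0)
    (λ i≢i → contradiction refl i≢i)
    (λ _ → ℕ.m≤n⇒m∸n≡0 i≤j)
    (λ k _ _ _ → ℕ.n∸n≡0 (toℕ k))

  transpose-left : PC.transpose i j i ≡ j
  transpose-left = transpose-elim (λ k l → k ≡ i → l ≡ j)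
    (λ _ → refl) sym (λ k k≢i _ k≡i → contradiction k≡i k≢i) i refl

-- Up to reindexing by v, this is the right-hand side of the triangle
-- inequality for w(v(k)), v(k), k, summed over k.
excess-sum : (v w : Permutation′ n) →
             excess w + excess v ≡
             ∑ λ k → (toℕ (w ⟨$⟩ʳ (v ⟨$⟩ʳ k)) ∸ toℕ (v ⟨$⟩ʳ k)) + (toℕ (v ⟨$⟩ʳ k) ∸ toℕ k)
excess-sum v w = trans
  (cong (_+ excess v) (sum-permute (λ k → toℕ (w ⟨$⟩ʳ k) ∸ toℕ k) v))
  (sym (∑-distrib-+ _ (λ k → toℕ (v ⟨$⟩ʳ k) ∸ toℕ k)))

excess-∘-≤ : (v w : Permutation′ n) → excess (v ∘ₚ w) ≤ excess w + excess v
excess-∘-≤ v w = ℕ.≤-trans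
  (∑-mono-≤ λ k → ∸-triangle (toℕ (w ⟨$⟩ʳ (v ⟨$⟩ʳ k))) (toℕ (v ⟨$⟩ʳ k)) (toℕ k))
  (ℕ.≤-reflexive (sym (excess-sum v w)))

excess-eval-≤ : ∀ {ts} → All (λ (i , j) → i Fin.< j) ts → excess {n} (eval ts) ≤ totalDepth ts
excess-eval-≤ {n} [] = ℕ.≤-reflexive (∑-zero {n} λ k → ℕ.n∸n≡0 (toℕ k))
excess-eval-≤ {ts = (i , j) ∷ ts} (i<j ∷ ps) = begin
  excess (transpose i j ∘ₚ eval ts)          ≤⟨ excess-∘-≤ (transpose i j) (eval ts) ⟩
  excess (eval ts) + excess (transpose i j)  ≤⟨ ℕ.+-mono-≤ (excess-eval-≤ ps)
                                                  (ℕ.≤-reflexive (excess-transpose (ℕ.<⇒≤ i<j))) ⟩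
  totalDepth ts + (toℕ j ∸ toℕ i)            ≡⟨ ℕ.+-comm (totalDepth ts) _ ⟩
  totalDepth ((i , j) ∷ ts)                  ∎
  where open ℕ.≤-Reasoning

module _ (w : Permutation′ n) where

  private
    f : Fin n → Fin n
    f = w ⟨$⟩ʳ_

  -- The orbit of i strictly increases for as long as it stays below b.
  climb : ∀ {b} → (∀ l → toℕ l < b → toℕ l ≤ toℕ (f l)) →
          ∀ {i} → Acc Fin._>_ i → toℕ i < toℕ (f i) → toℕ i < b →
          ∃ λ m → toℕ i ≤ toℕ m × toℕ m < b × b ≤ toℕ (f m)
  climb {b} up {i} (acc rs) i<fi i<b with toℕ (f i) ℕ.<? b
  ... | no fi≮b = i , ℕ.≤-refl , i<b , ℕ.≮⇒≥ fi≮b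
  ... | yes fi<b =
    let m , fi≤m , m<b , b≤fm = climb up (rs i<fi) fi<ffi fi<b
    in m , ℕ.≤-trans (ℕ.<⇒≤ i<fi) fi≤m , m<b , b≤fm
    where
    fi<ffi : toℕ (f i) < toℕ (f (f i))
    -- If `f i` were fixed, injectivity would make `i` fixed too.
    fi<ffi = ℕ.≤∧≢⇒< (up (f i) fi<b) λ eq →
      ℕ.<⇒≢ i<fi (cong toℕ (Injection.injective (↔⇒↣ w) (Fin.toℕ-injective eq)))

  -- j is the least element that f moves down; i is found by climbing from f(j).
  descent-pair : (∃₂ λ i j → toℕ i < toℕ j × toℕ j ≤ toℕ (f i) × toℕ (f j) ≤ toℕ i) ⊎
                 (∀ i → f i ≡ i)
  descent-pair with Fin.all? (λ i → i Fin.≤? f i)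
  ... | yes up = inj₂ fixed
    where
    fixed : ∀ i → f i ≡ i
    fixed i with i Fin.≟ f i
    ... | yes i≡fi = sym i≡fi
    -- Here `b` is `n`, which is why `climb` takes a number as its bound: a point that is not fixed
    -- would lead to an `m` with `f m` out of range.
    ... | no  i≢fi with climb (λ l _ → up l) (>-wellFounded i)
                          (ℕ.≤∧≢⇒< (up i) (i≢fi ∘ Fin.toℕ-injective)) (Fin.toℕ<n i)
    ...   | m , _ , _ , n≤fm = contradiction n≤fm (ℕ.<⇒≱ (Fin.toℕ<n (f m)))
  ... | no ¬up with Fin.¬∀⟶∃¬-smallest n _ (λ i → i Fin.≤? f i) ¬up
  ...   | j , j≰fj , below = inj₁ (i , j , i<j , j≤fi , fj≤i)
    where
    up : ∀ l → toℕ l < toℕ j → toℕ l ≤ toℕ (f l)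
    -- `below` speaks of elements of `Fin (toℕ j)` injected into `Fin n`; `fromℕ< l<j` is the one
    -- that injects to `l`.
    up l l<j = subst (λ k → toℕ k ≤ toℕ (f k))
      (Fin.toℕ-injective (trans (Fin.toℕ-inject (fromℕ< l<j)) (Fin.toℕ-fromℕ< l<j)))
      (below (fromℕ< l<j))

    fj<j : toℕ (f j) < toℕ j
    fj<j = ℕ.≰⇒> j≰fj

    fj<ffj : toℕ (f j) < toℕ (f (f j))
    -- Being below `j`, the point `f j` is not moved down; if it were fixed, so would `j` be.
    fj<ffj = ℕ.≤∧≢⇒< (up (f j) fj<j) λ eq →
      ℕ.<⇒≢ fj<j (sym (cong toℕ (Injection.injective (↔⇒↣ w) (Fin.toℕ-injective eq))))

    climbed = climb up (>-wellFounded (f j)) fj<ffj fj<j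
    i = proj₁ climbed
    fj≤i = proj₁ (proj₂ climbed)
    i<j = proj₁ (proj₂ (proj₂ climbed))
    j≤fi = proj₂ (proj₂ (proj₂ climbed))

-- `transpose j i` is the inverse of `transpose i j` in the form that `PC.transpose-inverse`
-- cancels, so `w` is `transpose i j` followed by the permutation on the right.
excess-split : (w : Permutation′ n) {i j : Fin n} → toℕ i < toℕ j →
               toℕ j ≤ toℕ (w ⟨$⟩ʳ i) → toℕ (w ⟨$⟩ʳ j) ≤ toℕ i →
               excess w ≡ excess (transpose j i ∘ₚ w) + (toℕ j ∸ toℕ i)
excess-split w {i} {j} i<j j≤wi wj≤i = begin
  excess w
    -- At `i`, the middle point `j` lies between `i` and `w(i)`. At `j`, all three differences
    -- truncate to 0, as `w(j) ≤ i < j`. Elsewhere the middle point is `k` itself.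
    ≡⟨ sum-cong-≗ (transpose-elim Additive
         (∸-split (ℕ.<⇒≤ i<j) j≤wi)
         (trans (ℕ.m≤n⇒m∸n≡0 (ℕ.≤-trans wj≤i (ℕ.<⇒≤ i<j)))
           (sym (cong₂ _+_ (ℕ.m≤n⇒m∸n≡0 wj≤i) (ℕ.m≤n⇒m∸n≡0 (ℕ.<⇒≤ i<j)))))
         (λ k _ _ → trans (sym (ℕ.+-identityʳ _))
           (cong (toℕ (w ⟨$⟩ʳ k) ∸ toℕ k +_) (sym (ℕ.n∸n≡0 (toℕ k)))))) ⟩
  ∑ (λ k → (toℕ (w ⟨$⟩ʳ k) ∸ toℕ (PC.transpose i j k)) + (toℕ (PC.transpose i j k) ∸ toℕ k))
    ≡⟨ sum-cong-≗ (λ k → cong (λ l → (toℕ (w ⟨$⟩ʳ l) ∸ toℕ (PC.transpose i j k))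
                                           + (toℕ (PC.transpose i j k) ∸ toℕ k))
         (PC.transpose-inverse j i)) ⟨
  ∑ (λ k → (toℕ (v ⟨$⟩ʳ (PC.transpose i j k)) ∸ toℕ (PC.transpose i j k))
             + (toℕ (PC.transpose i j k) ∸ toℕ k))
    ≡⟨ excess-sum (transpose i j) v ⟨
  excess v + excess (transpose i j)
    ≡⟨ cong (excess v +_) (excess-transpose (ℕ.<⇒≤ i<j)) ⟩
  excess v + (toℕ j ∸ toℕ i)
    ∎
  where
  open ≡-Reasoning
  v = transpose j i ∘ₚ w
  Additive : Fin _ → Fin _ → Set
  Additive k l = toℕ (w ⟨$⟩ʳ k) ∸ toℕ k ≡ (toℕ (w ⟨$⟩ʳ k) ∸ toℕ l) + (toℕ l ∸ toℕ k)

excess-attained : (w : Permutation′ n) → FactorizationDepth w (excess w)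
-- The induction on the excess quantifies over all `w`, since each step changes the permutation.
excess-attained w = <-rec (λ d → ∀ w → excess w ≡ d → FactorizationDepth w d) step _ w refl
  where
  step : ∀ d → (∀ {c} → c < d → ∀ w → excess w ≡ c → FactorizationDepth w c) →
         ∀ w → excess w ≡ d → FactorizationDepth w d
  step _ rec w refl with descent-pair w
  ... | inj₂ fixed = [] , ([] , sym ∘ fixed) ,
    sym (∑-zero λ k → trans (cong (λ l → toℕ l ∸ toℕ k) (fixed k)) (ℕ.n∸n≡0 (toℕ k)))
  ... | inj₁ (i , j , i<j , j≤wi , wj≤i)
    with split ← excess-split w i<j j≤wi wj≤i
    with ts , (ps , ts≈) , depth ← rec (subst (excess (transpose j i ∘ₚ w) <_) (sym split)
                                     (ℕ.m<m+n _ (ℕ.m<n⇒0<n∸m i<j)))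
                                   (transpose j i ∘ₚ w) refl
    -- `eval` applies the head first, so `(i , j)` cancels the `transpose j i` put before `w`.
    = (i , j) ∷ ts
    , (i<j ∷ ps , λ k → trans (ts≈ _) (cong (w ⟨$⟩ʳ_) (PC.transpose-inverse j i)))
    , trans (cong (toℕ j ∸ toℕ i +_) depth) (trans (ℕ.+-comm (toℕ j ∸ toℕ i) _) (sym split))

excess-isMinimum : (w : Permutation′ n) → IsMinimum (FactorizationDepth w) (excess w)
excess-isMinimum w = excess-attained w , λ where
  (ts , (ps , ts≈w) , refl) → ℕ.≤-trans
    (ℕ.≤-reflexive (sym (excess-cong {v = eval ts} {w} ts≈w)))
    (excess-eval-≤ ps)

sum-filter : ∀ {a p} {A : Set a} {P : Pred A p} (P? : Decidable P) (f : A → ℕ) →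
             (∀ x → ¬ P x → f x ≡ 0) → ∀ xs → sum (map f (filter P? xs)) ≡ sum (map f xs)
sum-filter P? f f≡0 [] = refl
sum-filter P? f f≡0 (x ∷ xs) with P? x
... | yes Px = cong (f x +_) (sum-filter P? f f≡0 xs)
... | no ¬Px = trans (sum-filter P? f f≡0 xs)
  (cong (_+ sum (map f xs)) (sym (f≡0 x ¬Px)))

theorem1p1 : (n : ℕ) → 1 ≤ n → (w : Permutation′ n) →
    dp w ≡ sum (map (λ i → toℕ (w ⟨$⟩ʳ i) ∸ toℕ i) (filter (λ i → i <? (w ⟨$⟩ʳ i)) (allFin n)))
theorem1p1 n _ w = begin
  dp w
    -- Both sides are minima of the same predicate, so each bounds the other.
    ≡⟨ ℕ.≤-antisym (proj₂ (dp-isMinimum w) (excess-attained w))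
         (proj₂ (excess-isMinimum w) (proj₁ (dp-isMinimum w))) ⟩
  excess w
    ≡⟨ sum-tabulate f ⟨
  sum (tabulate f)
    ≡⟨ cong sum (map-tabulate id f) ⟨
  sum (map f (allFin n))
    -- The terms that the filter drops have `w(i) ≤ i`, hence are 0 by truncation.
    ≡⟨ sum-filter _ f (λ i i≮wi → ℕ.m≤n⇒m∸n≡0 (ℕ.≮⇒≥ i≮wi)) (allFin n) ⟨
  sum (map f (filter (λ i → i <? (w ⟨$⟩ʳ i)) (allFin n)))
    ∎
  where
  open ≡-Reasoning
  f : Fin n → ℕ
  f i = toℕ (w ⟨$⟩ʳ i) ∸ toℕ i
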